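{- All the logical rules $0,+,\times,\sqcup,\sqcap$ of $\mathbf{HR}$ are CAN-free invertible: for every instance of one of these rules, if its conclusion has a CAN-free derivation in $\mathbf{HR}$, then each of its premises has a CAN-free derivation in $\mathbf{HR}$.
   Context: Terms. Fix a countable set of variables $x,y,z,\dots$. Terms (in negation normal form) are generated by $A ::= x \mid \overline{x} \mid 0 \mid A+A \mid rA \mid A\sqcup A \mid A\sqcap A$, where $x$ is a variable, $\overline{x}$ is the corresponding negated variable, and $r\in\mathbb{R}_{>0}$. The negation $\overline{A}$ of a term is defined by $\overline{x}$ (for $x$), $\overline{\overline{x}}=x$, $\overline{0}=0$, $\overline{A+B}=\overline{A}+\overline{B}$, $\overline{rA}=r\overline{A}$, $\overline{A\sqcup B}=\overline{A}\sqcap\overline{B}$, $\overline{A\sqcap B}=\overline{A}\sqcup\overline{B}$. A weighted term is $r.A$ with $r\in\mathbb{R}_{>0}$; a sequent $\vdash\Gamma$ has $\Gamma$ a finite (possibly empty) multiset of weighted terms; a hypersequent is a nonempty finite multiset of sequents, written $\vdash\Gamma_1\mid\cdots\mid\vdash\Gamma_n$, and $G\mid\vdash\Gamma$ denotes the hypersequent $G$ with the sequent $\vdash\Gamma$ added. For a finite (possibly empty) sequence $\vec r=(r_1,\dots,r_n)$ of strictly positive reals, $\vec r.A$ is the multiset $r_1.A,\dots,r_n.A$, $\sum\vec r=r_1+\dots+r_n$, and $s\vec r=(sr_1,\dots,sr_n)$; for $s>0$, $s.\Gamma$ multiplies every weight in $\Gamma$ by $s$. The calculus $\mathbf{HR}$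 has the rules (vectors are finite sequences of strictly positive reals): INIT: the hypersequent $\vdash$ (one empty sequent) with no premises. W: from $G$ infer $G\mid\vdash\Gamma$. C: from $G\mid\vdash\Gamma\mid\vdash\Gamma$ infer $G\mid\vdash\Gamma$. S: from $G\mid\vdash\Gamma_1,\Gamma_2$ infer $G\mid\vdash\Gamma_1\mid\vdash\Gamma_2$. M: from $G\mid\vdash\Gamma_1$ and $G\mid\vdash\Gamma_2$ infer $G\mid\vdash\Gamma_1,\Gamma_2$. T: for $r>0$, from $G\mid\vdash r.\Gamma$ infer $G\mid\vdash\Gamma$. ID: if $\sum\vec r=\sum\vec s$, from $G\mid\vdash\Gamma$ infer $G\mid\vdash\Gamma,\vec r.x,\vec s.\overline{x}$ ($x$ a variable). Logical rules — 0: from $G\mid\vdash\Gamma$ infer $G\mid\vdash\Gamma,\vec r.0$. $+$: from $G\mid\vdash\Gamma,\vec r.A,\vec r.B$ infer $G\mid\vdash\Gamma,\vec r.(A+B)$. $\times$: from $G\mid\vdash\Gamma,(s\vec r).A$ infer $G\mid\vdash\Gamma,\vec r.(sA)$. $\sqcup$: from $G\mid\vdash\Gamma,\vec r.A\mid\vdash\Gamma,\vec r.B$ infer $G\mid\vdash\Gamma,\vec r.(A\sqcup B)$. $\sqcap$: from $G\mid\vdash\Gamma,\vec r.A$ and $G\mid\vdash\Gamma,\vec r.B$ infer $G\mid\vdash\Gamma,\vec r.(A\sqcap B)$. CAN: if $\sum\vec r=\sum\vec s$, from $G\mid\vdash\Gamma,\vec s.A,\vec r.\overline{A}$ infer $G\mid\vdash\Gamma$.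 A derivation is a finite tree of rule instances whose leaves are INIT; it is CAN-free if it contains no instance of CAN. -}

module Defs where

open import Level using (0ℓ)
open import Data.Bool using (Bool; true; false)
open import Data.Nat using (ℕ)
open import Data.Product using (_×_; _,_; ∃)
open import Data.Sum using (_⊎_)
open import Data.List using (List; []; _∷_; _++_; map; foldr)
open import Data.List.Relation.Binary.Permutation.Propositional using (_↭_)
open import Data.List.Relation.Binary.Permutation.Homogeneous using (Permutation)
open import Relation.Nullary using (¬_)
open import Relation.Binary.Core using (Rel)
open import Relation.Binary.PropositionalEquality using (_≡_)
open import Relation.Binary.Structures using (IsStrictTotalOrder)
open import Algebra.Core using (Op₁; Op₂)
open import Algebra.Structures using (IsCommutativeRing)

record CompleteOrderedField : Set₁ where
  infixl 6 _+_
  infixl 7 _*_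
  infix 4 _<_ _≤_
  field
    Carrier : Set
    _+_ _*_ : Op₂ Carrier
    -_      : Op₁ Carrier
    0# 1#   : Carrier
    _<_     : Rel Carrier 0ℓ
    isCommutativeRing  : IsCommutativeRing _≡_ _+_ _*_ -_ 0# 1#
    0≢1                : ¬ (0# ≡ 1#)
    inverse            : ∀ x → ¬ (x ≡ 0#) → ∃ λ y → x * y ≡ 1#
    isStrictTotalOrder : IsStrictTotalOrder _≡_ _<_
    +-mono-<           : ∀ {x y} z → x < y → x + z < y + z
    *-pos              : ∀ {x y} → 0# < x → 0# < y → 0# < x * y

  _≤_ : Rel Carrier 0ℓ
  x ≤ y = x < y ⊎ x ≡ y

  field
    sup : (P : Carrier → Set) → ∃ P → ∃ (λ b → ∀ x → P x → x ≤ b) →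
          ∃ λ s → (∀ x → P x → x ≤ s) × (∀ b → (∀ x → P x → x ≤ b) → s ≤ b)

module HR (ℝ : CompleteOrderedField) where
  open CompleteOrderedField ℝ

  record ℝ⁺ : Set where
    constructor pos
    field
      val    : Carrier
      .val>0 : 0# < val
  open ℝ⁺ public

  _·⁺_ : ℝ⁺ → ℝ⁺ → ℝ⁺
  pos x p ·⁺ pos y q = pos (x * y) (*-pos p q)

  -- terms in negation normal form; variables are natural numbers
  infixl 6 _⊕_
  infixl 5 _⊔ₜ_ _⊓ₜ_
  data Term : Set where
    var   : ℕ → Term
    covar : ℕ → Term
    𝟘     : Term
    _⊕_   : Term → Term → Term
    _∙_   : ℝ⁺ → Term → Term
    _⊔ₜ_  : Term → Term → Term
    _⊓ₜ_  : Term → Term → Term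

  neg : Term → Term
  neg (var x)  = covar x
  neg (covar x) = var x
  neg 𝟘        = 𝟘
  neg (A ⊕ B)  = neg A ⊕ neg B
  neg (r ∙ A)  = r ∙ neg A
  neg (A ⊔ₜ B) = neg A ⊓ₜ neg B
  neg (A ⊓ₜ B) = neg A ⊔ₜ neg B

  -- weighted terms r.A, sequents (multisets of weighted terms, as lists
  -- up to permutation), hypersequents (multisets of sequents)
  WTerm : Set
  WTerm = ℝ⁺ × Term

  Sequent : Set
  Sequent = List WTerm

  Hyp : Set
  Hyp = List Sequent

  -- multiset equality of hypersequents: outer permutation, with the
  -- matched sequents equal as multisets (permutations)
  _≈ₕ_ : Hyp → Hyp → Set
  _≈ₕ_ = Permutation _↭_

  Vec⁺ : Set
  Vec⁺ = List ℝ⁺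

  _·ᵥ_ : Vec⁺ → Term → Sequent
  rs ·ᵥ A = map (λ r → (r , A)) rs

  Σ⁺ : Vec⁺ → Carrier
  Σ⁺ = foldr (λ r acc → val r + acc) 0#

  _⋆ᵥ_ : ℝ⁺ → Vec⁺ → Vec⁺
  s ⋆ᵥ rs = map (s ·⁺_) rs

  _⋆ₛ_ : ℝ⁺ → Sequent → Sequent
  s ⋆ₛ Γ = map (λ { (r , A) → (s ·⁺ r , A) }) Γ

  -- Derivability in HR.  The index says whether CAN may be used:
  -- Der false H  = H has a CAN-free derivation,
  -- Der true  H  = H has a derivation in HR.
  -- A hypersequent "G | ⊢ Γ" is written  Γ ∷ G  (G possibly empty);
  -- rule EXCH only expresses that hypersequents are multisets.
  data Der (can : Bool) : Hyp → Set where
    EXCH  : ∀ {H H′} → H ≈ₕ H′ → Der can H → Der can H′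
    INIT  : Der can ([] ∷ [])
    W     : ∀ {Δ G} Γ → Der can (Δ ∷ G) → Der can (Γ ∷ Δ ∷ G)
    C     : ∀ {G Γ} → Der can (Γ ∷ Γ ∷ G) → Der can (Γ ∷ G)
    S     : ∀ {G Γ₁ Γ₂} → Der can ((Γ₁ ++ Γ₂) ∷ G) → Der can (Γ₁ ∷ Γ₂ ∷ G)
    M     : ∀ {G Γ₁ Γ₂} → Der can (Γ₁ ∷ G) → Der can (Γ₂ ∷ G) →
            Der can ((Γ₁ ++ Γ₂) ∷ G)
    T     : ∀ {G Γ} (r : ℝ⁺) → Der can ((r ⋆ₛ Γ) ∷ G) → Der can (Γ ∷ G)
    ID    : ∀ {G Γ} (rs ss : Vec⁺) (x : ℕ) → Σ⁺ rs ≡ Σ⁺ ss →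
            Der can (Γ ∷ G) →
            Der can ((Γ ++ rs ·ᵥ var x ++ ss ·ᵥ covar x) ∷ G)
    ZERO  : ∀ {G Γ} (rs : Vec⁺) → Der can (Γ ∷ G) →
            Der can ((Γ ++ rs ·ᵥ 𝟘) ∷ G)
    PLUS  : ∀ {G Γ} (rs : Vec⁺) (A B : Term) →
            Der can ((Γ ++ rs ·ᵥ A ++ rs ·ᵥ B) ∷ G) →
            Der can ((Γ ++ rs ·ᵥ (A ⊕ B)) ∷ G)
    TIMES : ∀ {G Γ} (rs : Vec⁺) (s : ℝ⁺) (A : Term) →
            Der can ((Γ ++ (s ⋆ᵥ rs) ·ᵥ A) ∷ G) →
            Der can ((Γ ++ rs ·ᵥ (s ∙ A)) ∷ G)
    SUP   : ∀ {G Γ} (rs : Vec⁺) (A B : Term) →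
            Der can ((Γ ++ rs ·ᵥ A) ∷ (Γ ++ rs ·ᵥ B) ∷ G) →
            Der can ((Γ ++ rs ·ᵥ (A ⊔ₜ B)) ∷ G)
    INF   : ∀ {G Γ} (rs : Vec⁺) (A B : Term) →
            Der can ((Γ ++ rs ·ᵥ A) ∷ G) → Der can ((Γ ++ rs ·ᵥ B) ∷ G) →
            Der can ((Γ ++ rs ·ᵥ (A ⊓ₜ B)) ∷ G)
    CAN   : ∀ {G Γ} → can ≡ true → (rs ss : Vec⁺) (A : Term) →
            Σ⁺ rs ≡ Σ⁺ ss →
            Der can ((Γ ++ ss ·ᵥ A ++ rs ·ᵥ neg A) ∷ G) → Der can (Γ ∷ G)

  CANfree : Hyp → Set
  CANfree = Der false

{-# OPTIONS --safe #-}
-- Since M and S move formulas between sequents, one inverts a rule at an arbitrary selection of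
-- the occurrences of its principal formula A, simultaneously in all sequents, by induction on the
-- derivation. Every sequent Γ becomes two sequents X | Y, where each selected r.A is replaced by
-- a "left" part in X and a "right" part in Y; these differ only for ⊔, for the other rules
-- X | Y is contracted at the end.
--
-- The delicate steps are M, and the rule for A itself when only part of r⃗.A is selected. There
-- M and S produce mixed sequents Γ, r⃗.B, s⃗.C. Adding up the r-multiples and the s-multiples
-- of Γ, r⃗.B, s⃗.C gives, because weights commute, the sum of the r-multiples of Γ, r⃗.B, s⃗.B
-- and the s-multiples of Γ, r⃗.C, s⃗.C. So by M, S, T and C a mixed sequent yields the pure ones
-- Γ, r⃗.B, s⃗.B | Γ, r⃗.C, s⃗.C (for ⊔), and likewise two derivations of the pure ones yield the
-- mixed one (for ⊓).
module Submission where

open import Defs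
open import Level using (0ℓ)
open import Data.Empty using (⊥-elim; ⊥-elim-irr)
open import Data.List using (List; []; _∷_; _++_; [_]; concatMap)
open import Data.List.Properties using (map-++; ++-assoc)
import Data.List.Relation.Binary.Permutation.Homogeneous as Homogeneous
open import Data.List.Relation.Binary.Permutation.Propositional
  using (_↭_; refl; prep; swap; trans; ↭-refl; ↭-sym; ↭-trans; ↭-reflexive; module PermutationReasoning)
open import Data.List.Relation.Binary.Permutation.Propositional.Properties
  using (++⁺; ++⁺ˡ; ++⁺ʳ; ++-comm; shift; shifts; ++-commutativeMonoid)
  renaming (map⁺ to ↭-map⁺; ++-assoc to ↭-assoc; ++-identityʳ to ↭-identityʳ)
open import Data.List.Relation.Binary.Pointwise.Base using (Pointwise; []; _∷_)
open import Data.List.Relation.Unary.All as All using (All; []; _∷_)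
open import Data.List.Relation.Unary.Any using (Any; here; there)
open import Data.List.Relation.Unary.Any.Properties using () renaming (++⁺ʳ to Any-++⁺ʳ)
open import Data.Product using (_×_; _,_; ∃; ∃₂; proj₁; proj₂)
open import Data.Sum using (_⊎_; inj₁; inj₂)
open import Relation.Binary.Definitions using (tri<; tri≈; tri>)
open import Relation.Binary.PropositionalEquality
  using (_≡_; refl; sym; cong; cong₂; subst; subst₂)
  renaming (trans to ≡-trans)
open import Relation.Binary.Structures using (IsStrictTotalOrder)
open import Algebra.Bundles using (Ring)
open import Algebra.Structures using (IsCommutativeRing)
open import Relation.Nullary using (¬_)
import Algebra.Properties.Ring
import Algebra.Solver.CommutativeMonoid as CommutativeMonoidSolver

-- Arithmetic of strictly positive weights.

module PositiveReals (ℝ : CompleteOrderedField) where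
  open CompleteOrderedField ℝ
  open IsCommutativeRing isCommutativeRing using (*-assoc; *-comm; *-identityˡ; zeroʳ; -‿inverseʳ; +-identityˡ; isRing)
  open IsStrictTotalOrder isStrictTotalOrder using (compare) renaming (irrefl to <-irrefl; trans to <-trans)
  open HR ℝ

  val-injective : ∀ {r s : ℝ⁺} → val r ≡ val s → r ≡ s
  val-injective {pos x p} {pos .x q} refl = refl

  ·⁺-comm : ∀ r s → r ·⁺ s ≡ s ·⁺ r
  ·⁺-comm r s = val-injective (*-comm (val r) (val s))

  ·⁺-assoc : ∀ r s t → (r ·⁺ s) ·⁺ t ≡ r ·⁺ (s ·⁺ t)
  ·⁺-assoc r s t = val-injective (*-assoc (val r) (val s) (val t))

  ·⁺-leftComm : ∀ r s t → r ·⁺ (s ·⁺ t) ≡ s ·⁺ (r ·⁺ t)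
  ·⁺-leftComm r s t = ≡-trans (sym (·⁺-assoc r s t))
    (≡-trans (cong (_·⁺ t) (·⁺-comm r s)) (·⁺-assoc s r t))

  private
    ring : Ring 0ℓ 0ℓ
    ring = record { isRing = isRing }

    module RingProperties = Algebra.Properties.Ring ring

  negative-neg : ∀ {x} → x < 0# → 0# < - x
  negative-neg {x} x<0 = subst₂ _<_ (-‿inverseʳ x) (+-identityˡ (- x)) (+-mono-< (- x) x<0)

  -- If `- 1#` were positive, so would be its square `1#`, while adding `- (- 1#)` to both sides of
  -- the assumption gives `1# < 0#`.
  0≮-1 : ¬ 0# < - 1#
  0≮-1 0<-1 = <-irrefl refl (<-trans 0<1 (subst (_< 0#) (RingProperties.-‿involutive 1#) -[-1]<0))
    where
    0<1 : 0# < 1#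
    0<1 = subst (0# <_)
      (≡-trans (RingProperties.-1*x≈-x (- 1#)) (RingProperties.-‿involutive 1#)) (*-pos 0<-1 0<-1)
    -[-1]<0 : - (- 1#) < 0#
    -[-1]<0 = subst₂ _<_ (+-identityˡ _) (-‿inverseʳ (- 1#)) (+-mono-< (- (- 1#)) 0<-1)

  -- A zero `y` would identify `0#` with `1#`, and a negative one would make `x * - y`, which is
  -- `- 1#`, positive.
  inverse-pos : ∀ {x y} → 0# < x → x * y ≡ 1# → 0# < y
  inverse-pos {x} {y} 0<x xy≡1 with compare 0# y
  ... | tri< 0<y _ _ = 0<y
  ... | tri≈ _ refl _ = ⊥-elim (0≢1 (≡-trans (sym (zeroʳ x)) xy≡1))
  ... | tri> _ _ y<0 = ⊥-elim (0≮-1 (subst (0# <_)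
          (≡-trans (sym (RingProperties.-‿distribʳ-* x y)) (cong -_ xy≡1)) (*-pos 0<x (negative-neg y<0))))

  -- Stated as cancellation, the form in which `⋆ₛ-cancel` uses the inverse.
  inverse⁺ : ∀ r → ∃ λ s → ∀ t → s ·⁺ (r ·⁺ t) ≡ t
  inverse⁺ (pos x 0<x) with inverse x (λ x≡0 → ⊥-elim-irr (<-irrefl (sym x≡0) 0<x))
  ... | y , xy≡1 = pos y (inverse-pos 0<x xy≡1) , λ t → val-injective
    (≡-trans (sym (*-assoc y x (val t)))
      (≡-trans (cong (_* val t) (≡-trans (*-comm y x) xy≡1)) (*-identityˡ (val t))))

-- Rearrangements of concatenated lists.

module Permutations {A : Set} where
  open CommutativeMonoidSolver (++-commutativeMonoid {A = A})
    using (solve; _⊜_) renaming (_⊕_ to _⊙_)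

  interchange : ∀ (a b c d : List A) → (a ++ b) ++ (c ++ d) ↭ (a ++ c) ++ (b ++ d)
  interchange = solve 4 (λ a b c d → ((a ⊙ b) ⊙ (c ⊙ d)) ⊜ ((a ⊙ c) ⊙ (b ⊙ d))) refl

  transposition : ∀ (a b c d : List A) → (a ++ b) ++ (c ++ d) ↭ (c ++ b) ++ (a ++ d)
  transposition = solve 4 (λ a b c d → ((a ⊙ b) ⊙ (c ⊙ d)) ⊜ ((c ⊙ b) ⊙ (a ⊙ d))) refl

  exchange : ∀ (a b c d e f : List A) →
    (a ++ (b ++ c)) ++ (d ++ (e ++ f)) ↭ (a ++ (b ++ e)) ++ (d ++ (c ++ f))
  exchange = solve 6 (λ a b c d e f →
    ((a ⊙ (b ⊙ c)) ⊙ (d ⊙ (e ⊙ f))) ⊜ ((a ⊙ (b ⊙ e)) ⊙ (d ⊙ (c ⊙ f)))) refl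

-- Derived structural rules and sums of multiples of a sequent.

module Derivations (ℝ : CompleteOrderedField) where
  open HR ℝ
  open PositiveReals ℝ
  open Permutations

  ≈ₕ-refl : ∀ {H} → H ≈ₕ H
  ≈ₕ-refl {H} = Homogeneous.refl (pointwise H)
    where
    pointwise : ∀ H → Pointwise _↭_ H H
    pointwise []      = []
    pointwise (Γ ∷ H) = ↭-refl ∷ pointwise H

  ↭⇒≈ₕ : ∀ {H K} → H ↭ K → H ≈ₕ K
  ↭⇒≈ₕ refl        = ≈ₕ-refl
  ↭⇒≈ₕ (prep Γ p)   = Homogeneous.prep ↭-refl (↭⇒≈ₕ p)
  ↭⇒≈ₕ (swap Γ Δ p) = Homogeneous.swap ↭-refl ↭-refl (↭⇒≈ₕ p)
  ↭⇒≈ₕ (trans p q)  = Homogeneous.trans (↭⇒≈ₕ p) (↭⇒≈ₕ q)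

  infix 4 _∈ₕ_ _⊑_

  -- Membership and inclusion are up to permutation and ignore multiplicity, as suits the presence
  -- of `W` and `C`.
  _∈ₕ_ : Sequent → Hyp → Set
  Γ ∈ₕ H = Any (Γ ↭_) H

  _⊑_ : Hyp → Hyp → Set
  H ⊑ K = All (_∈ₕ K) H

  pattern 0th p = here p
  pattern 1st p = there (here p)
  pattern 2nd p = there (there (here p))
  pattern 3rd p = there (there (there (here p)))

  ⊑-skip : ∀ {H K Γ} → H ⊑ K → H ⊑ Γ ∷ K
  ⊑-skip = All.map there

  ⊑-refl : ∀ {H} → H ⊑ H
  ⊑-refl {[]}    = []
  ⊑-refl {Γ ∷ H} = here ↭-refl ∷ ⊑-skip ⊑-refl

  weaken : ∀ K {Γ H} → CANfree (Γ ∷ H) → CANfree (K ++ Γ ∷ H)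
  weaken []          d = d
  weaken (Δ ∷ [])    d = W Δ d
  weaken (Δ ∷ Θ ∷ K) d = W Δ (weaken (Θ ∷ K) d)

  ∈ₕ⇒≈ₕ : ∀ {Γ H} → Γ ∈ₕ H → ∃₂ λ Δ K → Γ ↭ Δ × H ↭ Δ ∷ K
  ∈ₕ⇒≈ₕ (here {Δ} {K} p) = Δ , K , p , ↭-refl
  ∈ₕ⇒≈ₕ (there {Θ} i) with ∈ₕ⇒≈ₕ i
  ... | Δ , K , p , q = Δ , Θ ∷ K , p , trans (prep Θ q) (swap Θ Δ refl)

  absorb : ∀ {Γ H} → Γ ∈ₕ H → CANfree (Γ ∷ H) → CANfree H
  absorb i d with ∈ₕ⇒≈ₕ i
  ... | Δ , K , p , q =
    EXCH (↭⇒≈ₕ (↭-sym q)) (C (EXCH (Homogeneous.prep p (↭⇒≈ₕ q)) d))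

  -- Bundles exchange, weakening and contraction: all of `K` is added by weakening, then each
  -- sequent of `Γ ∷ H` is absorbed into its copy in `K`. The premise is nonempty because `W` cannot
  -- start from the empty hypersequent.
  structural : ∀ {Γ H K} → Γ ∷ H ⊑ K → CANfree (Γ ∷ H) → CANfree K
  structural {Γ} {H} {K} i d = contract (Γ ∷ H) i
    (EXCH (↭⇒≈ₕ (++-comm K (Γ ∷ H))) (weaken K d))
    where
    contract : ∀ H → H ⊑ K → CANfree (H ++ K) → CANfree K
    contract []      []       d = d
    contract (Γ ∷ H) (i ∷ is) d = contract H is (absorb (Any-++⁺ʳ H i) d)

  exchange₁ : ∀ {Γ Δ G} → Γ ↭ Δ → CANfree (Γ ∷ G) → CANfree (Δ ∷ G)
  exchange₁ p = EXCH (Homogeneous.prep p ≈ₕ-refl)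

  swap₂ : ∀ {Γ Δ G} → CANfree (Γ ∷ Δ ∷ G) → CANfree (Δ ∷ Γ ∷ G)
  swap₂ = EXCH (Homogeneous.swap ↭-refl ↭-refl ≈ₕ-refl)

  onSecond : ∀ {Γ Δ Θ G} → (∀ {G} → CANfree (Δ ∷ G) → CANfree (Θ ∷ G)) →
    CANfree (Γ ∷ Δ ∷ G) → CANfree (Γ ∷ Θ ∷ G)
  onSecond f d = swap₂ (f (swap₂ d))

  ⊢[] : ∀ {G} → CANfree ([] ∷ G)
  ⊢[] = structural (here refl ∷ []) INIT

  ⋆ₛ-++ : ∀ s Γ Δ → s ⋆ₛ (Γ ++ Δ) ≡ s ⋆ₛ Γ ++ s ⋆ₛ Δ
  ⋆ₛ-++ s = map-++ _

  ⋆ₛ-cancel : ∀ r s → (∀ t → s ·⁺ (r ·⁺ t) ≡ t) → ∀ Γ → s ⋆ₛ (r ⋆ₛ Γ) ≡ Γ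
  ⋆ₛ-cancel r s inv []            = refl
  ⋆ₛ-cancel r s inv ((t , A) ∷ Γ) = cong₂ _∷_ (cong (_, A) (inv t)) (⋆ₛ-cancel r s inv Γ)

  -- The converse of `T`, obtained from `T` with the inverse scalar.
  scale : ∀ r {Γ G} → CANfree (Γ ∷ G) → CANfree (r ⋆ₛ Γ ∷ G)
  scale r {Γ} {G} d with inverse⁺ r
  ... | s , inv = T s (subst (λ Δ → CANfree (Δ ∷ G)) (sym (⋆ₛ-cancel r s inv Γ)) d)

  multiples : Vec⁺ → Sequent → Sequent
  multiples rs Γ = concatMap (_⋆ₛ Γ) rs

  multiples⁺ : ∀ rs {Γ G} → CANfree (Γ ∷ G) → CANfree (multiples rs Γ ∷ G)
  multiples⁺ []       d = ⊢[]
  multiples⁺ (r ∷ rs) d = M (scale r d) (multiples⁺ rs d)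

  -- `S` separates the multiples, `T` removes the scalars and `C` merges the equal results. The list
  -- must be nonempty, since the empty sum is always derivable.
  multiples⁻ : ∀ r rs {Γ G} → CANfree (multiples (r ∷ rs) Γ ∷ G) → CANfree (Γ ∷ G)
  multiples⁻ r []        d = T r (exchange₁ (↭-identityʳ _) d)
  multiples⁻ r (r′ ∷ rs) d =
    C (multiples⁻ r′ rs (swap₂ (T r (S d))))

  multiples-++ : ∀ rs Γ Δ → multiples rs (Γ ++ Δ) ↭ multiples rs Γ ++ multiples rs Δ
  multiples-++ []       Γ Δ = refl
  multiples-++ (r ∷ rs) Γ Δ = begin
    r ⋆ₛ (Γ ++ Δ) ++ multiples rs (Γ ++ Δ)
      ↭⟨ ++⁺ (↭-reflexive (⋆ₛ-++ r Γ Δ)) (multiples-++ rs Γ Δ) ⟩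
    (r ⋆ₛ Γ ++ r ⋆ₛ Δ) ++ (multiples rs Γ ++ multiples rs Δ)
      ↭⟨ interchange (r ⋆ₛ Γ) (r ⋆ₛ Δ) (multiples rs Γ) (multiples rs Δ) ⟩
    (r ⋆ₛ Γ ++ multiples rs Γ) ++ (r ⋆ₛ Δ ++ multiples rs Δ) ∎
    where open PermutationReasoning

  Homogeneous⁺ : (ℝ⁺ → Sequent) → Set
  Homogeneous⁺ R = ∀ s r → R (s ·⁺ r) ≡ s ⋆ₛ R r

  -- Both sides are the sum of `R (r ·⁺ s)` over all `r` in `rs` and `s` in `ss`, because weights
  -- commute.
  multiples-swap : ∀ {R} → Homogeneous⁺ R → ∀ rs ss →
    multiples rs (concatMap R ss) ↭ multiples ss (concatMap R rs)
  multiples-swap {R} hom rs [] = ↭-reflexive (multiples-[] rs)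
    where
    multiples-[] : ∀ rs → multiples rs [] ≡ []
    multiples-[] []       = refl
    multiples-[] (r ∷ rs) = multiples-[] rs
  multiples-swap {R} hom rs (s ∷ ss) = begin
    multiples rs (R s ++ concatMap R ss)
      ↭⟨ multiples-++ rs (R s) (concatMap R ss) ⟩
    multiples rs (R s) ++ multiples rs (concatMap R ss)
      ↭⟨ ++⁺ (↭-reflexive (single rs)) (multiples-swap hom rs ss) ⟩
    s ⋆ₛ concatMap R rs ++ multiples ss (concatMap R rs) ∎
    where
    open PermutationReasoning
    single : ∀ rs → multiples rs (R s) ≡ s ⋆ₛ concatMap R rs
    single []       = refl
    single (r ∷ rs) = ≡-trans
      (cong₂ _++_ (≡-trans (sym (hom r s)) (≡-trans (cong R (·⁺-comm r s)) (hom s r))) (single rs))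
      (sym (⋆ₛ-++ s (R r) (concatMap R rs)))

  -- Passing between mixed and pure sequents.

  module Convexity {R₁ R₂ : ℝ⁺ → Sequent}
    (hom₁ : Homogeneous⁺ R₁) (hom₂ : Homogeneous⁺ R₂) where

    -- After distributing, two blocks trade places and are rewritten by `multiples-swap`: the
    -- `rs`-multiples of `R₁* ss` become the `ss`-multiples of `R₁* rs`, and the `ss`-multiples of
    -- `R₂* rs` become the `rs`-multiples of `R₂* ss`.
    multiples-exchange : ∀ Δ rs ss →
      multiples rs (Δ ++ concatMap R₁ rs ++ concatMap R₁ ss) ++
      multiples ss (Δ ++ concatMap R₂ rs ++ concatMap R₂ ss) ↭
      multiples rs (Δ ++ concatMap R₁ rs ++ concatMap R₂ ss) ++
      multiples ss (Δ ++ concatMap R₁ rs ++ concatMap R₂ ss)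
    multiples-exchange Δ rs ss = begin
      multiples rs (Δ ++ R₁* rs ++ R₁* ss) ++ multiples ss (Δ ++ R₂* rs ++ R₂* ss)
        ↭⟨ ++⁺ (distribute rs (R₁* rs) (R₁* ss)) (distribute ss (R₂* rs) (R₂* ss)) ⟩
      (rs · Δ ++ (rs · R₁* rs ++ rs · R₁* ss)) ++ (ss · Δ ++ (ss · R₂* rs ++ ss · R₂* ss))
        ↭⟨ exchange (rs · Δ) (rs · R₁* rs) (rs · R₁* ss) (ss · Δ) (ss · R₂* rs) (ss · R₂* ss) ⟩
      (rs · Δ ++ (rs · R₁* rs ++ ss · R₂* rs)) ++ (ss · Δ ++ (rs · R₁* ss ++ ss · R₂* ss))
        ↭⟨ ++⁺ (++⁺ˡ (rs · Δ) (++⁺ˡ (rs · R₁* rs) (multiples-swap hom₂ ss rs)))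
               (++⁺ˡ (ss · Δ) (++⁺ʳ (ss · R₂* ss) (multiples-swap hom₁ rs ss))) ⟩
      (rs · Δ ++ (rs · R₁* rs ++ rs · R₂* ss)) ++ (ss · Δ ++ (ss · R₁* rs ++ ss · R₂* ss))
        ↭⟨ ++⁺ (distribute rs (R₁* rs) (R₂* ss)) (distribute ss (R₁* rs) (R₂* ss)) ⟨
      multiples rs (Δ ++ R₁* rs ++ R₂* ss) ++ multiples ss (Δ ++ R₁* rs ++ R₂* ss) ∎
      where
      open PermutationReasoning
      infixr 6 _·_
      _·_ : Vec⁺ → Sequent → Sequent
      _·_ = multiples
      R₁* R₂* : Vec⁺ → Sequent
      R₁* = concatMap R₁
      R₂* = concatMap R₂
      distribute : ∀ ts Θ Ξ → multiples ts (Δ ++ Θ ++ Ξ) ↭ ts · Δ ++ (ts · Θ ++ ts · Ξ)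
      distribute ts Θ Ξ = ↭-trans (multiples-++ ts Δ (Θ ++ Ξ)) (++⁺ˡ (ts · Δ) (multiples-++ ts Θ Ξ))

    unmix : ∀ {G} Δ rs ss →
      CANfree ((Δ ++ concatMap R₁ rs ++ concatMap R₂ ss) ∷ G) →
      CANfree ((Δ ++ concatMap R₁ rs ++ concatMap R₁ ss) ∷
               (Δ ++ concatMap R₂ rs ++ concatMap R₂ ss) ∷ G)
    -- With `rs` or `ss` empty, `multiples⁻` does not apply, but the mixed sequent is already one of
    -- the pure ones.
    unmix Δ []       ss d = W _ d
    unmix Δ (r ∷ rs) [] d = swap₂ (W _ d)
    unmix Δ (r ∷ rs) (s ∷ ss) d =
      multiples⁻ r rs (onSecond (multiples⁻ s ss) (S
        (exchange₁ (↭-sym (multiples-exchange Δ (r ∷ rs) (s ∷ ss)))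
          (M (multiples⁺ (r ∷ rs) d) (multiples⁺ (s ∷ ss) d)))))

    -- The rearrangement of `unmix` in the opposite direction. Both halves now strip down to the
    -- same mixed sequent, so a final `C` merges them.
    mix : ∀ {G} Δ rs ss →
      CANfree ((Δ ++ concatMap R₁ rs ++ concatMap R₁ ss) ∷ G) →
      CANfree ((Δ ++ concatMap R₂ rs ++ concatMap R₂ ss) ∷ G) →
      CANfree ((Δ ++ concatMap R₁ rs ++ concatMap R₂ ss) ∷ G)
    mix Δ []       ss d₁ d₂ = d₂
    mix Δ (r ∷ rs) [] d₁ d₂ = d₁
    mix Δ (r ∷ rs) (s ∷ ss) d₁ d₂ =
      C (multiples⁻ r rs (onSecond (multiples⁻ s ss) (S
        (exchange₁ (multiples-exchange Δ (r ∷ rs) (s ∷ ss))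
          (M (multiples⁺ (r ∷ rs) d₁) (multiples⁺ (s ∷ ss) d₂))))))

  -- Merging hypersequents with two active sequents.

  distribute : ∀ {Γ Γ₁ Γ₂ G H} → G ⊑ H →
    CANfree (Γ ∷ H) → CANfree (Γ₁ ∷ Γ₂ ∷ G) →
    CANfree ((Γ ++ Γ₁) ∷ (Γ ++ Γ₂) ∷ H)
  distribute {Γ} {Γ₁} {Γ₂} i d e = swap₂ (M
    (structural (0th ↭-refl ∷ ⊑-skip (⊑-skip ⊑-refl)) d)
    (swap₂ (M
      (structural (0th ↭-refl ∷ ⊑-skip (⊑-skip ⊑-refl)) d)
      (structural (0th refl ∷ 1st refl ∷ ⊑-skip (⊑-skip i)) e))))

  -- `M` acts on one sequent at a time, so all four combinations arise; `▷-unmix₂` later removes the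
  -- mixed ones.
  distribute₂ : ∀ {Γ₁ Γ₂ Δ₁ Δ₂ G} → CANfree (Γ₁ ∷ Γ₂ ∷ G) → CANfree (Δ₁ ∷ Δ₂ ∷ G) →
    CANfree ((Γ₂ ++ Δ₁) ∷ (Γ₂ ++ Δ₂) ∷ (Γ₁ ++ Δ₁) ∷ (Γ₁ ++ Δ₂) ∷ G)
  distribute₂ d e = distribute (⊑-skip (⊑-skip ⊑-refl))
    (structural (1st refl ∷ 2nd refl ∷ 0th refl ∷ ⊑-skip (⊑-skip (⊑-skip ⊑-refl)))
      (distribute (⊑-skip ⊑-refl) d e)) e

  -- `M` joins the unwanted sequents `Γ₂` and `Δ₁`, the hypothesis regroups their sum as `Γ₁ ++ Δ₂`,
  -- and `S` splits it into copies of sequents already present.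
  cross : ∀ {Γ₁ Γ₂ Δ₁ Δ₂ G} → Γ₂ ++ Δ₁ ↭ Γ₁ ++ Δ₂ →
    CANfree (Γ₁ ∷ Γ₂ ∷ G) → CANfree (Δ₁ ∷ Δ₂ ∷ G) → CANfree (Γ₁ ∷ Δ₂ ∷ G)
  cross p d e = structural (0th refl ∷ 1st refl ∷ ⊑-refl) (S (exchange₁ p (M
    (structural (1st refl ∷ 0th refl ∷ ⊑-skip (⊑-skip (⊑-skip ⊑-refl))) d)
    (structural (0th refl ∷ 2nd refl ∷ ⊑-skip (⊑-skip (⊑-skip ⊑-refl))) e))))

-- Replacing selected occurrences of a principal formula.

module Replacement (ℝ : CompleteOrderedField) where
  open HR ℝ
  open PositiveReals ℝ
  open Permutations
  open Derivations ℝ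

  -- inf A B D stands for inverting ⊓ towards the premise with D, which is A or B.
  data Connective : Set where
    zero  : Connective
    plus  : Term → Term → Connective
    times : ℝ⁺ → Term → Connective
    sup   : Term → Term → Connective
    inf   : ∀ (A B D : Term) → D ≡ A ⊎ D ≡ B → Connective

  principal : Connective → Term
  principal zero          = 𝟘
  principal (plus A B)    = A ⊕ B
  principal (times s A)   = s ∙ A
  principal (sup A B)     = A ⊔ₜ B
  principal (inf A B _ _) = A ⊓ₜ B

  only : Term → ℝ⁺ → Sequent
  only A r = [ (r , A) ]

  -- Every connective gets two parts so that ⊔, whose premise has two active sequents, fits the same
  -- induction as the others.
  left right : Connective → ℝ⁺ → Sequent
  left zero          r = []
  left (plus A B)    r = (r , A) ∷ (r , B) ∷ []
  left (times s A)   r = [ (s ·⁺ r , A) ]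
  left (sup A B)     r = only A r
  left (inf _ _ D _) r = only D r
  right (sup A B) = only B
  right c         = left c

  left* right* : Connective → Vec⁺ → Sequent
  left* c  = concatMap (left c)
  right* c = concatMap (right c)

  left-homogeneous : ∀ c → Homogeneous⁺ (left c)
  left-homogeneous zero          s r = refl
  left-homogeneous (plus A B)    s r = refl
  left-homogeneous (times t A)   s r = cong (λ u → [ (u , A) ]) (·⁺-leftComm t s r)
  left-homogeneous (sup A B)     s r = refl
  left-homogeneous (inf _ _ D _) s r = refl

  right-homogeneous : ∀ c → Homogeneous⁺ (right c)
  right-homogeneous zero             = left-homogeneous zero
  right-homogeneous (plus A B)       = left-homogeneous (plus A B)
  right-homogeneous (times t A)      = left-homogeneous (times t A)
  right-homogeneous (sup A B)    s r = refl
  right-homogeneous (inf A B D e)    = left-homogeneous (inf A B D e)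

  infix 4 _▷[_]_∣_ _▷ₕ[_]_

  -- `keep` is allowed on occurrences of `principal c` too, so the relation ranges over all
  -- selections of occurrences.
  data Step (c : Connective) : WTerm → Sequent → Sequent → Set where
    keep    : ∀ a → Step c a [ a ] [ a ]
    replace : ∀ r → Step c (r , principal c) (left c r) (right c r)

  data _▷[_]_∣_ : Sequent → Connective → Sequent → Sequent → Set where
    []  : ∀ {c} → [] ▷[ c ] [] ∣ []
    _∷_ : ∀ {c a Γ X Y X′ Y′} → Step c a X Y → Γ ▷[ c ] X′ ∣ Y′ →
          a ∷ Γ ▷[ c ] X ++ X′ ∣ Y ++ Y′

  data _▷ₕ[_]_ : Hyp → Connective → Hyp → Set where
    []  : ∀ {c} → [] ▷ₕ[ c ] []
    _∷_ : ∀ {c Γ X Y G K} → Γ ▷[ c ] X ∣ Y → G ▷ₕ[ c ] K → Γ ∷ G ▷ₕ[ c ] X ∷ Y ∷ K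

  keepAll : ∀ {c} Γ → Γ ▷[ c ] Γ ∣ Γ
  keepAll []      = []
  keepAll (a ∷ Γ) = keep a ∷ keepAll Γ

  replaceAll : ∀ {c} rs → rs ·ᵥ principal c ▷[ c ] left* c rs ∣ right* c rs
  replaceAll []       = []
  replaceAll (r ∷ rs) = replace r ∷ replaceAll rs

  ▷-++⁺ : ∀ {c Γ Δ X X′ Y Y′} → Γ ▷[ c ] X ∣ Y → Δ ▷[ c ] X′ ∣ Y′ →
    Γ ++ Δ ▷[ c ] X ++ X′ ∣ Y ++ Y′
  ▷-++⁺ [] h = h
  ▷-++⁺ (_∷_ {c} {a} {Γ} {X} {Y} {X′} {Y′} s g) h =
    subst₂ (λ U V → _ ▷[ c ] U ∣ V) (sym (++-assoc X X′ _)) (sym (++-assoc Y Y′ _)) (s ∷ ▷-++⁺ g h)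

  data Split (c : Connective) (Γ Δ X Y : Sequent) : Set where
    split : ∀ {X₁ X₂ Y₁ Y₂} → Γ ▷[ c ] X₁ ∣ Y₁ → Δ ▷[ c ] X₂ ∣ Y₂ →
      X ↭ X₁ ++ X₂ → Y ↭ Y₁ ++ Y₂ → Split c Γ Δ X Y

  ▷-++⁻ : ∀ {c} Γ {Δ X Y} → Γ ++ Δ ▷[ c ] X ∣ Y → Split c Γ Δ X Y
  ▷-++⁻ []      g = split [] g refl refl
  ▷-++⁻ (a ∷ Γ) (_∷_ {X = X} {Y = Y} s g) with ▷-++⁻ Γ g
  ... | split {X₁} {X₂} {Y₁} {Y₂} g₁ g₂ p q = split (s ∷ g₁) g₂
    (↭-trans (++⁺ˡ X p) (↭-sym (↭-assoc X X₁ X₂)))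
    (↭-trans (++⁺ˡ Y q) (↭-sym (↭-assoc Y Y₁ Y₂)))

  -- Serves the rule `T`: homogeneity of `left` and `right` makes replacement commute with scaling.
  ▷-⋆ₛ : ∀ {c Γ X Y} r → Γ ▷[ c ] X ∣ Y → r ⋆ₛ Γ ▷[ c ] r ⋆ₛ X ∣ r ⋆ₛ Y
  ▷-⋆ₛ r [] = []
  ▷-⋆ₛ {c} r (_∷_ {X = X} {Y} {X′} {Y′} s g) =
    subst₂ (λ U V → _ ▷[ c ] U ∣ V) (sym (⋆ₛ-++ r X X′)) (sym (⋆ₛ-++ r Y Y′)) (scaleStep s ∷ ▷-⋆ₛ r g)
    where
    scaleStep : ∀ {t A X Y} → Step c (t , A) X Y → Step c (r ·⁺ t , A) (r ⋆ₛ X) (r ⋆ₛ Y)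
    scaleStep (keep _)    = keep _
    scaleStep (replace t) =
      subst₂ (Step c _) (left-homogeneous c r t) (right-homogeneous c r t) (replace (r ·⁺ t))

  -- Selections are pulled back from conclusion to premise, the direction in which `invert` meets
  -- `EXCH`.
  ▷-↭ : ∀ {c Γ Γ′ X′ Y′} → Γ ↭ Γ′ → Γ′ ▷[ c ] X′ ∣ Y′ →
    ∃₂ λ X Y → Γ ▷[ c ] X ∣ Y × X ↭ X′ × Y ↭ Y′
  ▷-↭ refl g = _ , _ , g , refl , refl
  ▷-↭ (prep a e) (_∷_ {X = X} {Y} s g) with ▷-↭ e g
  ... | _ , _ , g′ , p , q = _ , _ , s ∷ g′ , ++⁺ˡ X p , ++⁺ˡ Y q
  ▷-↭ (swap a b e) (_∷_ {X = X₁} {Y₁} s (_∷_ {X = X₂} {Y₂} t g)) with ▷-↭ e g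
  ... | U , V , g′ , p , q = _ , _ , t ∷ (s ∷ g′) ,
    ↭-trans (shifts X₂ X₁) (++⁺ˡ X₁ (++⁺ˡ X₂ p)) ,
    ↭-trans (shifts Y₂ Y₁) (++⁺ˡ Y₁ (++⁺ˡ Y₂ q))
  ▷-↭ (trans e f) g with ▷-↭ f g
  ... | _ , _ , g₁ , p₁ , q₁ with ▷-↭ e g₁
  ... | _ , _ , g₂ , p₂ , q₂ = _ , _ , g₂ , ↭-trans p₂ p₁ , ↭-trans q₂ q₁

  ▷ₕ-≈ₕ : ∀ {c H H′ K′} → H ≈ₕ H′ → H′ ▷ₕ[ c ] K′ → ∃ λ K → H ▷ₕ[ c ] K × K ≈ₕ K′
  ▷ₕ-≈ₕ (Homogeneous.refl []) [] = [] , [] , ≈ₕ-refl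
  ▷ₕ-≈ₕ (Homogeneous.refl (e ∷ es)) (g ∷ k) with ▷-↭ e g | ▷ₕ-≈ₕ (Homogeneous.refl es) k
  ... | _ , _ , g′ , p , q | _ , k′ , r =
    _ , g′ ∷ k′ , Homogeneous.prep p (Homogeneous.prep q r)
  ▷ₕ-≈ₕ (Homogeneous.prep e es) (g ∷ k) with ▷-↭ e g | ▷ₕ-≈ₕ es k
  ... | _ , _ , g′ , p , q | _ , k′ , r =
    _ , g′ ∷ k′ , Homogeneous.prep p (Homogeneous.prep q r)
  ▷ₕ-≈ₕ (Homogeneous.swap e f es) (_∷_ {X = X₁} {Y₁} g (_∷_ {X = X₂} {Y₂} h k))
    with ▷-↭ e h | ▷-↭ f g | ▷ₕ-≈ₕ es k
  ... | _ , _ , g′ , p , q | _ , _ , h′ , p′ , q′ | _ , k′ , r =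
    -- Each sequent has become a pair, so swapping two sequents swaps two adjacent pairs.
    _ , g′ ∷ (h′ ∷ k′) , Homogeneous.trans
      (Homogeneous.prep p (Homogeneous.prep q (Homogeneous.prep p′ (Homogeneous.prep q′ r))))
      (↭⇒≈ₕ (shifts (X₂ ∷ Y₂ ∷ []) (X₁ ∷ Y₁ ∷ [])))
  ▷ₕ-≈ₕ (Homogeneous.trans e f) k with ▷ₕ-≈ₕ f k
  ... | _ , k₁ , p₁ with ▷ₕ-≈ₕ e k₁
  ... | _ , k₂ , p₂ = _ , k₂ , Homogeneous.trans p₂ p₁

  -- The last component of parts says that only principal formulas are replaced.
  data Parts (c : Connective) (rs : Vec⁺) (A : Term) (X Y : Sequent) : Set where
    parts : ∀ kept replaced → rs ↭ kept ++ replaced →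
      X ↭ left* c replaced ++ kept ·ᵥ A → Y ↭ right* c replaced ++ kept ·ᵥ A →
      replaced ≡ [] ⊎ A ≡ principal c → Parts c rs A X Y

  ▷-parts : ∀ {c X Y} rs A → rs ·ᵥ A ▷[ c ] X ∣ Y → Parts c rs A X Y
  ▷-parts []       A [] = parts [] [] refl refl refl (inj₁ refl)
  ▷-parts {c} (r ∷ rs) A (keep _ ∷ g) with ▷-parts rs A g
  ... | parts ks ts e p q o = parts (r ∷ ks) ts (prep r e)
    (↭-trans (prep _ p) (↭-sym (shift _ (left* c ts) _)))
    (↭-trans (prep _ q) (↭-sym (shift _ (right* c ts) _))) o
  ▷-parts {c} (r ∷ rs) A (replace _ ∷ g) with ▷-parts rs A g
  ... | parts ks ts e p q o = parts ks (r ∷ ts)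
    (↭-trans (prep r e) (↭-sym (shift r ks ts)))
    (↭-trans (++⁺ˡ (left c r) p) (↭-sym (↭-assoc (left c r) _ _)))
    (↭-trans (++⁺ˡ (right c r) q) (↭-sym (↭-assoc (right c r) _ _))) (inj₂ refl)

  allKept : ∀ {rs ks A} → rs ↭ ks ++ [] → ks ·ᵥ A ↭ rs ·ᵥ A
  allKept {ks = ks} e = ↭-map⁺ _ (↭-trans (↭-sym (↭-identityʳ ks)) (↭-sym e))

  ▷-kept : ∀ {c X Y} rs A → ¬ A ≡ principal c → rs ·ᵥ A ▷[ c ] X ∣ Y →
    X ↭ rs ·ᵥ A × Y ↭ rs ·ᵥ A
  ▷-kept rs A A≢ g with ▷-parts rs A g
  ... | parts ks ts e p q (inj₂ eq)   = ⊥-elim (A≢ eq)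
  ... | parts ks _ e p q (inj₁ refl) = ↭-trans p (allKept e) , ↭-trans q (allKept e)

  var≢principal : ∀ c {x} → ¬ var x ≡ principal c
  var≢principal zero          ()
  var≢principal (plus _ _)    ()
  var≢principal (times _ _)   ()
  var≢principal (sup _ _)     ()
  var≢principal (inf _ _ _ _) ()

  covar≢principal : ∀ c {x} → ¬ covar x ≡ principal c
  covar≢principal zero          ()
  covar≢principal (plus _ _)    ()
  covar≢principal (times _ _)   ()
  covar≢principal (sup _ _)     ()
  covar≢principal (inf _ _ _ _) ()

  -- Brings a selection into the shape required by `Convexity`: the kept part is common to both
  -- sides, which differ only in the replacements of one list of weights.
  ▷-decompose : ∀ {c Γ X Y} → Γ ▷[ c ] X ∣ Y →
    ∃₂ λ Δ rs → X ↭ Δ ++ left* c rs × Y ↭ Δ ++ right* c rs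
  ▷-decompose [] = [] , [] , refl , refl
  ▷-decompose (keep a ∷ g) with ▷-decompose g
  ... | Δ , rs , p , q = a ∷ Δ , rs , prep a p , prep a q
  ▷-decompose {c} (replace r ∷ g) with ▷-decompose g
  ... | Δ , rs , p , q = Δ , r ∷ rs ,
    ↭-trans (++⁺ˡ (left c r) p) (shifts (left c r) Δ) ,
    ↭-trans (++⁺ˡ (right c r) q) (shifts (right c r) Δ)

  combine : ∀ Γ Δ Θ Ξ {X Y : Sequent} → X ↭ Γ ++ Θ → Y ↭ Δ ++ Ξ →
    X ++ Y ↭ (Γ ++ Δ) ++ Θ ++ Ξ
  combine Γ Δ Θ Ξ p q = ↭-trans (++⁺ p q) (interchange Γ Θ Δ Ξ)

  ▷-unmix : ∀ {c Γ Δ X₁ X₂ Y₁ Y₂ G} → Γ ▷[ c ] X₁ ∣ Y₁ → Δ ▷[ c ] X₂ ∣ Y₂ →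
    CANfree ((X₁ ++ Y₂) ∷ G) → CANfree ((X₁ ++ X₂) ∷ (Y₁ ++ Y₂) ∷ G)
  ▷-unmix {c} g h d with ▷-decompose g | ▷-decompose h
  ... | Δ₁ , rs , p₁ , q₁ | Δ₂ , ss , p₂ , q₂ =
    exchange₁ (↭-sym (combine Δ₁ Δ₂ (left* c rs) (left* c ss) p₁ p₂))
      (onSecond (exchange₁ (↭-sym (combine Δ₁ Δ₂ (right* c rs) (right* c ss) q₁ q₂)))
        (Convexity.unmix {left c} {right c} (left-homogeneous c) (right-homogeneous c) (Δ₁ ++ Δ₂) rs ss
          (exchange₁ (combine Δ₁ Δ₂ (left* c rs) (right* c ss) p₁ q₂) d)))

  -- One unmixing turns `X₁ ++ Y₂` into the pure pair; a second, with `g` and `h` exchanged, does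
  -- the same to `Y₁ ++ X₂`. Contraction merges the copies.
  ▷-unmix₂ : ∀ {c Γ Δ X₁ X₂ Y₁ Y₂ G} → Γ ▷[ c ] X₁ ∣ Y₁ → Δ ▷[ c ] X₂ ∣ Y₂ →
    CANfree ((Y₁ ++ X₂) ∷ (Y₁ ++ Y₂) ∷ (X₁ ++ X₂) ∷ (X₁ ++ Y₂) ∷ G) →
    CANfree ((X₁ ++ X₂) ∷ (Y₁ ++ Y₂) ∷ G)
  ▷-unmix₂ {c} {X₁ = X₁} {X₂} {Y₁} {Y₂} g h d =
    structural (0th (++-comm X₂ X₁) ∷ 1st (++-comm Y₂ Y₁) ∷ ⊑-refl) (▷-unmix h g
      (structural (1st refl ∷ 2nd refl ∷ 0th refl ∷ 1st refl ∷ 2nd refl ∷ ⊑-skip (⊑-skip (⊑-skip ⊑-refl)))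
        (▷-unmix g h
          (structural
            (1st (++-comm Y₁ X₂) ∷ 3rd refl ∷ 2nd refl ∷ 0th refl ∷
              ⊑-skip (⊑-skip (⊑-skip (⊑-skip ⊑-refl)))) d))))

-- Inversion by induction on the derivation, rule by rule.

module Invertibility (ℝ : CompleteOrderedField) where
  open HR ℝ
  open Permutations
  open Derivations ℝ
  open Replacement ℝ

  -- `F` stands for the active formulas of a rule's premise as a function of the weights. The
  -- replaced weights `ts` come first, to match `Parts`.
  Additive : (Vec⁺ → Sequent) → Set
  Additive F = ∀ {rs} ks ts → rs ↭ ks ++ ts → F rs ↭ F ts ++ F ks

  ·ᵥ-additive : ∀ A → Additive (_·ᵥ A)
  ·ᵥ-additive A ks ts e = ↭-trans (↭-map⁺ _ e)
    (↭-trans (↭-reflexive (map-++ _ ks ts)) (++-comm (ks ·ᵥ A) (ts ·ᵥ A)))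

  -- By additivity the premise for `rs` consists of `F ts`, which stays as the replacement, and
  -- `F ks`, to which the rule is applied with the kept weights only.
  partially : ∀ {Γ X U ks ts rs F A} → Additive F →
    (∀ {Γ G} → CANfree ((Γ ++ F ks) ∷ G) → CANfree ((Γ ++ ks ·ᵥ A) ∷ G)) →
    rs ↭ ks ++ ts → X ↭ Γ ++ U → U ↭ F ts ++ ks ·ᵥ A →
    ∀ {G} → CANfree ((Γ ++ F rs) ∷ G) → CANfree (X ∷ G)
  partially {Γ} {ks = ks} {ts} {F = F} {A} add rule e p u d =
    exchange₁ (↭-trans (↭-assoc Γ (F ts) (ks ·ᵥ A)) (↭-sym (↭-trans p (++⁺ˡ Γ u))))
      (rule (exchange₁ (↭-trans (++⁺ˡ Γ (add ks ts e)) (↭-sym (↭-assoc Γ (F ts) (F ks)))) d))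

  -- Common treatment of 0, + and ×, with `partially` applied in both sequents. The disjunction
  -- comes from `Parts`: either nothing is replaced, or the rule introduces the formula being
  -- inverted.
  twice : ∀ {c Γ₁ Γ₂ X Y X′ Y′ K F₁ F₂ rs A} →
    X ↭ Γ₁ ++ X′ → Y ↭ Γ₂ ++ Y′ → rs ·ᵥ A ▷[ c ] X′ ∣ Y′ →
    Additive F₁ → Additive F₂ →
    (∀ ts → ts ≡ [] ⊎ A ≡ principal c → left* c ts ↭ F₁ ts) →
    (∀ ts → ts ≡ [] ⊎ A ≡ principal c → right* c ts ↭ F₂ ts) →
    (∀ rs {Γ G} → CANfree ((Γ ++ F₁ rs) ∷ G) → CANfree ((Γ ++ rs ·ᵥ A) ∷ G)) →
    (∀ rs {Γ G} → CANfree ((Γ ++ F₂ rs) ∷ G) → CANfree ((Γ ++ rs ·ᵥ A) ∷ G)) →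
    CANfree ((Γ₁ ++ F₁ rs) ∷ (Γ₂ ++ F₂ rs) ∷ K) → CANfree (X ∷ Y ∷ K)
  twice {rs = rs} {A} p q g add₁ add₂ left↭ right↭ rule₁ rule₂ d with ▷-parts rs A g
  ... | parts ks ts e p′ q′ o =
    partially add₁ (rule₁ ks) e p (↭-trans p′ (++⁺ʳ _ (left↭ ts o)))
      (onSecond (partially add₂ (rule₂ ks) e q (↭-trans q′ (++⁺ʳ _ (right↭ ts o)))) d)

  []-additive : Additive (λ _ → [])
  []-additive ks ts e = refl

  ⊕-additive : ∀ A B → Additive (λ rs → rs ·ᵥ A ++ rs ·ᵥ B)
  ⊕-additive A B ks ts e = ↭-trans (++⁺ (·ᵥ-additive A ks ts e) (·ᵥ-additive B ks ts e))
    (interchange (ts ·ᵥ A) (ks ·ᵥ A) (ts ·ᵥ B) (ks ·ᵥ B))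

  ⋆ᵥ-additive : ∀ s A → Additive (λ rs → (s ⋆ᵥ rs) ·ᵥ A)
  ⋆ᵥ-additive s A ks ts e = ·ᵥ-additive A (s ⋆ᵥ ks) (s ⋆ᵥ ts)
    (↭-trans (↭-map⁺ _ e) (↭-reflexive (map-++ _ ks ts)))

  concatMap-only : ∀ A rs → concatMap (only A) rs ≡ rs ·ᵥ A
  concatMap-only A []       = refl
  concatMap-only A (r ∷ rs) = cong ((r , A) ∷_) (concatMap-only A rs)

  zero-premise : ∀ c ts → ts ≡ [] ⊎ 𝟘 ≡ principal c → left* c ts ↭ [] × right* c ts ↭ []
  zero-premise c    .[] (inj₁ refl) = refl , refl
  zero-premise zero ts  (inj₂ refl) = erased ts , erased ts
    where
    erased : ∀ ts → left* zero ts ↭ []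
    erased []       = refl
    erased (t ∷ ts) = erased ts

  plus-premise : ∀ c {A B} ts → ts ≡ [] ⊎ A ⊕ B ≡ principal c →
    left* c ts ↭ ts ·ᵥ A ++ ts ·ᵥ B × right* c ts ↭ ts ·ᵥ A ++ ts ·ᵥ B
  plus-premise c .[] (inj₁ refl) = refl , refl
  plus-premise (plus A B) ts (inj₂ refl) = unzipped ts , unzipped ts
    where
    unzipped : ∀ ts → left* (plus A B) ts ↭ ts ·ᵥ A ++ ts ·ᵥ B
    unzipped []       = refl
    unzipped (t ∷ ts) = prep _ (↭-trans (prep _ (unzipped ts)) (↭-sym (shift _ (ts ·ᵥ A) _)))

  times-premise : ∀ c {s A} ts → ts ≡ [] ⊎ s ∙ A ≡ principal c →
    left* c ts ↭ (s ⋆ᵥ ts) ·ᵥ A × right* c ts ↭ (s ⋆ᵥ ts) ·ᵥ A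
  times-premise c .[] (inj₁ refl) = refl , refl
  times-premise (times s A) ts (inj₂ refl) = scaled ts , scaled ts
    where
    scaled : ∀ ts → left* (times s A) ts ↭ (s ⋆ᵥ ts) ·ᵥ A
    scaled []       = refl
    scaled (t ∷ ts) = prep _ (scaled ts)

  M-case : ∀ {c Γ₁ Γ₂ X Y X₁ X₂ Y₁ Y₂ K} →
    Γ₁ ▷[ c ] X₁ ∣ Y₁ → Γ₂ ▷[ c ] X₂ ∣ Y₂ → X ↭ X₁ ++ X₂ → Y ↭ Y₁ ++ Y₂ →
    CANfree (X₁ ∷ Y₁ ∷ K) → CANfree (X₂ ∷ Y₂ ∷ K) → CANfree (X ∷ Y ∷ K)
  M-case g h p q d e = exchange₁ (↭-sym p) (onSecond (exchange₁ (↭-sym q))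
    (▷-unmix₂ g h (distribute₂ d e)))

  SUPˡ : ∀ rs A B {Γ G} → CANfree ((Γ ++ rs ·ᵥ A) ∷ G) → CANfree ((Γ ++ rs ·ᵥ (A ⊔ₜ B)) ∷ G)
  SUPˡ rs A B d = SUP rs A B (swap₂ (W _ d))

  SUPʳ : ∀ rs A B {Γ G} → CANfree ((Γ ++ rs ·ᵥ B) ∷ G) → CANfree ((Γ ++ rs ·ᵥ (A ⊔ₜ B)) ∷ G)
  SUPʳ rs A B d = SUP rs A B (W _ d)

  SUP₂ : ∀ rs A B {Γ₁ Γ₂ G} →
    CANfree ((Γ₁ ++ rs ·ᵥ A) ∷ (Γ₂ ++ rs ·ᵥ A) ∷ (Γ₁ ++ rs ·ᵥ B) ∷ (Γ₂ ++ rs ·ᵥ B) ∷ G) →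
    CANfree ((Γ₁ ++ rs ·ᵥ (A ⊔ₜ B)) ∷ (Γ₂ ++ rs ·ᵥ (A ⊔ₜ B)) ∷ G)
  SUP₂ rs A B d = swap₂ (SUP rs A B (structural
    (2nd refl ∷ 0th refl ∷ 1st refl ∷ ⊑-skip (⊑-skip (⊑-skip ⊑-refl)))
    (SUP rs A B (structural
      (0th refl ∷ 2nd refl ∷ 1st refl ∷ 3rd refl ∷ ⊑-skip (⊑-skip (⊑-skip (⊑-skip ⊑-refl)))) d))))

  -- If `rs ·ᵥ (A ⊔ₜ B)` counts as entirely replaced, the four sequents are exactly the combinations
  -- that `▷-unmix₂` expects.
  SUP-principal : ∀ {A B Γ Γ₁ Γ₂ G} rs → Γ ▷[ sup A B ] Γ₁ ∣ Γ₂ →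
    CANfree ((Γ₁ ++ rs ·ᵥ A) ∷ (Γ₂ ++ rs ·ᵥ A) ∷ (Γ₁ ++ rs ·ᵥ B) ∷ (Γ₂ ++ rs ·ᵥ B) ∷ G) →
    CANfree ((Γ₁ ++ rs ·ᵥ A) ∷ (Γ₂ ++ rs ·ᵥ B) ∷ G)
  SUP-principal {A} {B} rs g d = ▷-unmix₂ g
    (subst₂ (λ U V → rs ·ᵥ (A ⊔ₜ B) ▷[ sup A B ] U ∣ V)
      (concatMap-only A rs) (concatMap-only B rs) (replaceAll rs))
    (structural
      (2nd refl ∷ 0th refl ∷ 3rd refl ∷ 1st refl ∷ ⊑-skip (⊑-skip (⊑-skip (⊑-skip ⊑-refl)))) d)

  SUP-case : ∀ c {Γ Γ₁ Γ₂ X Y X′ Y′ K} rs A B → Γ ▷[ c ] Γ₁ ∣ Γ₂ →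
    X ↭ Γ₁ ++ X′ → Y ↭ Γ₂ ++ Y′ → rs ·ᵥ (A ⊔ₜ B) ▷[ c ] X′ ∣ Y′ →
    CANfree ((Γ₁ ++ rs ·ᵥ A) ∷ (Γ₂ ++ rs ·ᵥ A) ∷ (Γ₁ ++ rs ·ᵥ B) ∷ (Γ₂ ++ rs ·ᵥ B) ∷ K) →
    CANfree (X ∷ Y ∷ K)
  SUP-case c rs A B g p q h d with ▷-parts rs (A ⊔ₜ B) h
  SUP-case c {Γ₁ = Γ₁} {Γ₂} rs A B g p q h d | parts ks _ e p′ q′ (inj₁ refl) =
    exchange₁ (↭-sym (↭-trans p (++⁺ˡ Γ₁ (↭-trans p′ (allKept e)))))
      (onSecond (exchange₁ (↭-sym (↭-trans q (++⁺ˡ Γ₂ (↭-trans q′ (allKept e))))))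
        (SUP₂ rs A B d))
  SUP-case (sup A B) rs .A .B g p q h d | parts ks ts e p′ q′ (inj₂ refl) =
    -- The kept weights are reintroduced from `A` alone in `X` and from `B` alone in `Y`, the other
    -- disjunct being supplied by weakening.
    partially (·ᵥ-additive A) (SUPˡ ks A B) e p
      (↭-trans p′ (++⁺ʳ _ (↭-reflexive (concatMap-only A ts))))
      (onSecond
        (partially (·ᵥ-additive B) (SUPʳ ks A B) e q
          (↭-trans q′ (++⁺ʳ _ (↭-reflexive (concatMap-only B ts)))))
        (SUP-principal rs g d))

  -- Introducing ⊓ in two sequents takes all four choices of `A` and `B`; the two unequal choices
  -- come from `cross`.
  INF₂ : ∀ rs A B {Γ₁ Γ₂ G} →
    CANfree ((Γ₁ ++ rs ·ᵥ A) ∷ (Γ₂ ++ rs ·ᵥ A) ∷ G) →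
    CANfree ((Γ₁ ++ rs ·ᵥ B) ∷ (Γ₂ ++ rs ·ᵥ B) ∷ G) →
    CANfree ((Γ₁ ++ rs ·ᵥ (A ⊓ₜ B)) ∷ (Γ₂ ++ rs ·ᵥ (A ⊓ₜ B)) ∷ G)
  INF₂ rs A B {Γ₁} {Γ₂} d e = INF rs A B
    (swap₂ (INF rs A B (swap₂ d) (swap₂ (cross (transpose A B) d e))))
    (swap₂ (INF rs A B (swap₂ (cross (transpose B A) e d)) (swap₂ e)))
    where
    transpose : ∀ A B → (Γ₂ ++ rs ·ᵥ A) ++ (Γ₁ ++ rs ·ᵥ B) ↭ (Γ₁ ++ rs ·ᵥ A) ++ (Γ₂ ++ rs ·ᵥ B)
    transpose A B = transposition Γ₂ (rs ·ᵥ A) Γ₁ (rs ·ᵥ B)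

  ▷-inf-same : ∀ {A B D i Γ X Y} → Γ ▷[ inf A B D i ] X ∣ Y → X ≡ Y
  ▷-inf-same []              = refl
  ▷-inf-same (keep a ∷ g)    = cong (a ∷_) (▷-inf-same g)
  ▷-inf-same (replace r ∷ g) = cong (_ ∷_) (▷-inf-same g)

  only-mix : ∀ A B Γ ts ks {rs G} → rs ↭ ks ++ ts →
    CANfree ((Γ ++ rs ·ᵥ A) ∷ G) → CANfree ((Γ ++ rs ·ᵥ B) ∷ G) →
    CANfree (((Γ ++ ts ·ᵥ A) ++ ks ·ᵥ B) ∷ G)
  only-mix A B Γ ts ks {rs} e d d′ = exchange₁
    (↭-trans (++⁺ˡ Γ (++⁺ (toWeighted A ts) (toWeighted B ks))) (↭-sym (↭-assoc Γ _ _)))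
    (Convexity.mix {only A} {only B} (λ _ _ → refl) (λ _ _ → refl) Γ ts ks
      (exchange₁ (divide A) d) (exchange₁ (divide B) d′))
    where
    toWeighted : ∀ A rs → concatMap (only A) rs ↭ rs ·ᵥ A
    toWeighted A rs = ↭-reflexive (concatMap-only A rs)
    divide : ∀ A → Γ ++ rs ·ᵥ A ↭ Γ ++ concatMap (only A) ts ++ concatMap (only A) ks
    divide A = ++⁺ˡ Γ (↭-trans (·ᵥ-additive A ks ts e)
      (↭-sym (++⁺ (toWeighted A ts) (toWeighted A ks))))

  -- Reintroducing ⊓ at the kept weights needs `ts ·ᵥ D` next to `ks ·ᵥ A` and next to `ks ·ᵥ B`.
  -- One of these is mixed, so both premises enter whichever `D` is chosen.
  INF-principal : ∀ {A B D Γ G} rs ks ts → D ≡ A ⊎ D ≡ B → rs ↭ ks ++ ts →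
    CANfree ((Γ ++ rs ·ᵥ A) ∷ G) → CANfree ((Γ ++ rs ·ᵥ B) ∷ G) →
    CANfree (((Γ ++ ts ·ᵥ D) ++ ks ·ᵥ (A ⊓ₜ B)) ∷ G)
  INF-principal {A} {B} {Γ = Γ} rs ks ts (inj₁ refl) e d₁ d₂ =
    INF ks A B (only-mix A A Γ ts ks e d₁ d₁) (only-mix A B Γ ts ks e d₁ d₂)
  INF-principal {A} {B} {Γ = Γ} rs ks ts (inj₂ refl) e d₁ d₂ =
    INF ks A B (only-mix B A Γ ts ks e d₂ d₁) (only-mix B B Γ ts ks e d₂ d₂)

  INF-case : ∀ c {Γ Γ₁ Γ₂ X Y X′ Y′ K} rs A B → Γ ▷[ c ] Γ₁ ∣ Γ₂ →
    X ↭ Γ₁ ++ X′ → Y ↭ Γ₂ ++ Y′ → rs ·ᵥ (A ⊓ₜ B) ▷[ c ] X′ ∣ Y′ →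
    CANfree ((Γ₁ ++ rs ·ᵥ A) ∷ (Γ₂ ++ rs ·ᵥ A) ∷ K) →
    CANfree ((Γ₁ ++ rs ·ᵥ B) ∷ (Γ₂ ++ rs ·ᵥ B) ∷ K) →
    CANfree (X ∷ Y ∷ K)
  INF-case c rs A B g p q h d e with ▷-parts rs (A ⊓ₜ B) h
  INF-case c {Γ₁ = Γ₁} {Γ₂} rs A B g p q h d e | parts ks _ f p′ q′ (inj₁ refl) =
    exchange₁ (↭-sym (↭-trans p (++⁺ˡ Γ₁ (↭-trans p′ (allKept f)))))
      (onSecond (exchange₁ (↭-sym (↭-trans q (++⁺ˡ Γ₂ (↭-trans q′ (allKept f))))))
        (INF₂ rs A B d e))
  INF-case (inf A B D i) {Γ₁ = Γ₁} rs .A .B g p q h d e | parts ks ts f p′ q′ (inj₂ refl)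
    with ▷-inf-same g
  -- As `Γ₁` and `Γ₂` coincide, `C` reduces each premise to a single active sequent; `Y` is restored
  -- by weakening.
  ... | refl = swap₂ (W _ (exchange₁
    (↭-trans (↭-assoc Γ₁ _ _) (↭-sym (↭-trans p (++⁺ˡ Γ₁
      (↭-trans p′ (++⁺ʳ _ (↭-reflexive (concatMap-only D ts))))))))
    (INF-principal rs ks ts i f (C d) (C e))))

  -- The selection is an argument of the induction, so that each premise can receive its own. `CAN`
  -- is excluded, as it would require `false ≡ true`.
  invert : ∀ {c H K} → H ▷ₕ[ c ] K → CANfree H → CANfree K
  invert k (EXCH e d) with ▷ₕ-≈ₕ e k
  ... | _ , k′ , e′ = EXCH e′ (invert k′ d)
  invert ([] ∷ []) INIT = W [] INIT
  invert (g ∷ (h ∷ k)) (W Γ d) = W _ (W _ (invert (h ∷ k) d))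
  invert (g ∷ k) (C d) =
    structural (0th refl ∷ 1st refl ∷ ⊑-refl) (invert (g ∷ (g ∷ k)) d)
  -- The selections of both sequents join in the premise; `S` then splits the left sequent and the
  -- right one.
  invert (_∷_ {X = X₁} {Y₁} g (_∷_ {X = X₂} {Y₂} h k)) (S d) =
    structural (1st refl ∷ 3rd refl ∷ 0th refl ∷ 2nd refl ∷ ⊑-skip (⊑-skip (⊑-skip (⊑-skip ⊑-refl))))
      (S {Γ₁ = Y₁} {Y₂} (structural (1st refl ∷ 2nd refl ∷ 0th refl ∷ ⊑-skip (⊑-skip (⊑-skip ⊑-refl)))
        (S {Γ₁ = X₁} {X₂} (invert (▷-++⁺ g h ∷ k) d))))
  invert (g ∷ k) (M {Γ₁ = Γ₁} d e) with ▷-++⁻ Γ₁ g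
  ... | split g₁ g₂ p q = M-case g₁ g₂ p q (invert (g₁ ∷ k) d) (invert (g₂ ∷ k) e)
  invert (g ∷ k) (T r d) = T r (onSecond (T r) (invert (▷-⋆ₛ r g ∷ k) d))
  invert {c} (g ∷ k) (ID {Γ = Γ} rs ss x eq d) with ▷-++⁻ Γ g
  ... | split g₁ h p q with ▷-++⁻ (rs ·ᵥ var x) h
  ... | split h₁ h₂ p′ q′
    with ▷-kept rs (var x) (var≢principal c) h₁ | ▷-kept ss (covar x) (covar≢principal c) h₂
  ... | u₁ , v₁ | u₂ , v₂ =
    exchange₁ (↭-sym (↭-trans p (++⁺ˡ _ (↭-trans p′ (++⁺ u₁ u₂)))))
      (ID rs ss x eq (onSecond
        (λ d → exchange₁ (↭-sym (↭-trans q (++⁺ˡ _ (↭-trans q′ (++⁺ v₁ v₂))))) (ID rs ss x eq d))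
        (invert (g₁ ∷ k) d)))
  invert {c} (g ∷ k) (ZERO {Γ = Γ} rs d) with ▷-++⁻ Γ g
  ... | split g₁ h p q = twice p q h []-additive []-additive
    (λ ts o → proj₁ (zero-premise c ts o)) (λ ts o → proj₂ (zero-premise c ts o))
    zeroRule zeroRule
    (exchange₁ (↭-sym (↭-identityʳ _)) (onSecond (exchange₁ (↭-sym (↭-identityʳ _)))
      (invert (g₁ ∷ k) d)))
    where
    zeroRule : ∀ rs {Γ G} → CANfree ((Γ ++ []) ∷ G) → CANfree ((Γ ++ rs ·ᵥ 𝟘) ∷ G)
    zeroRule rs d = ZERO rs (exchange₁ (↭-identityʳ _) d)
  -- Here and in the cases below, the active formulas of the premise are kept, even where they
  -- happen to equal `principal c`.
  invert {c} (g ∷ k) (PLUS {Γ = Γ} rs A B d) with ▷-++⁻ Γ g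
  ... | split g₁ h p q = twice p q h (⊕-additive A B) (⊕-additive A B)
    (λ ts o → proj₁ (plus-premise c ts o)) (λ ts o → proj₂ (plus-premise c ts o))
    (λ rs → PLUS rs A B) (λ rs → PLUS rs A B)
    (invert (▷-++⁺ g₁ (keepAll _) ∷ k) d)
  invert {c} (g ∷ k) (TIMES {Γ = Γ} rs s A d) with ▷-++⁻ Γ g
  ... | split g₁ h p q = twice p q h (⋆ᵥ-additive s A) (⋆ᵥ-additive s A)
    (λ ts o → proj₁ (times-premise c ts o)) (λ ts o → proj₂ (times-premise c ts o))
    (λ rs → TIMES rs s A) (λ rs → TIMES rs s A)
    (invert (▷-++⁺ g₁ (keepAll _) ∷ k) d)
  invert (g ∷ k) (SUP {Γ = Γ} rs A B d) with ▷-++⁻ Γ g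
  ... | split g₁ h p q = SUP-case _ rs A B g₁ p q h
    (invert (▷-++⁺ g₁ (keepAll _) ∷ (▷-++⁺ g₁ (keepAll _) ∷ k)) d)
  invert (g ∷ k) (INF {Γ = Γ} rs A B d e) with ▷-++⁻ Γ g
  ... | split g₁ h p q = INF-case _ rs A B g₁ p q h
    (invert (▷-++⁺ g₁ (keepAll _) ∷ k) d) (invert (▷-++⁺ g₁ (keepAll _) ∷ k) e)

  -- A context in which nothing is replaced still gets doubled; the inclusion lets `structural`
  -- contract it again.
  keepAllₕ : ∀ {c} G → ∃ λ K → G ▷ₕ[ c ] K × K ⊑ G
  keepAllₕ []      = [] , [] , []
  keepAllₕ (Γ ∷ G) with keepAllₕ G
  ... | K , k , i = Γ ∷ Γ ∷ K , keepAll Γ ∷ k , 0th refl ∷ 0th refl ∷ ⊑-skip i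

  invert-principal : ∀ c Γ rs {G Γ₁ Γ₂} → left* c rs ↭ Γ₁ → right* c rs ↭ Γ₂ →
    CANfree ((Γ ++ rs ·ᵥ principal c) ∷ G) → CANfree ((Γ ++ Γ₁) ∷ (Γ ++ Γ₂) ∷ G)
  invert-principal c Γ rs {G} p q d with keepAllₕ G
  ... | K , k , i = structural (0th (++⁺ˡ Γ p) ∷ 1st (++⁺ˡ Γ q) ∷ ⊑-skip (⊑-skip i))
    (invert (▷-++⁺ (keepAll Γ) (replaceAll rs) ∷ k) d)

theorem3p11 : (ℝ : CompleteOrderedField) → let open HR ℝ in
    -- rule 0
    (∀ (G : Hyp) (Γ : Sequent) (rs : Vec⁺) →
       CANfree ((Γ ++ rs ·ᵥ 𝟘) ∷ G) → CANfree (Γ ∷ G)) ×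
    -- rule +
    (∀ (G : Hyp) (Γ : Sequent) (rs : Vec⁺) (A B : Term) →
       CANfree ((Γ ++ rs ·ᵥ (A ⊕ B)) ∷ G) →
       CANfree ((Γ ++ rs ·ᵥ A ++ rs ·ᵥ B) ∷ G)) ×
    -- rule ×
    (∀ (G : Hyp) (Γ : Sequent) (rs : Vec⁺) (s : ℝ⁺) (A : Term) →
       CANfree ((Γ ++ rs ·ᵥ (s ∙ A)) ∷ G) →
       CANfree ((Γ ++ (s ⋆ᵥ rs) ·ᵥ A) ∷ G)) ×
    -- rule ⊔
    (∀ (G : Hyp) (Γ : Sequent) (rs : Vec⁺) (A B : Term) →
       CANfree ((Γ ++ rs ·ᵥ (A ⊔ₜ B)) ∷ G) →
       CANfree ((Γ ++ rs ·ᵥ A) ∷ (Γ ++ rs ·ᵥ B) ∷ G)) ×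
    -- rule ⊓ (both premises)
    (∀ (G : Hyp) (Γ : Sequent) (rs : Vec⁺) (A B : Term) →
       CANfree ((Γ ++ rs ·ᵥ (A ⊓ₜ B)) ∷ G) →
       CANfree ((Γ ++ rs ·ᵥ A) ∷ G) × CANfree ((Γ ++ rs ·ᵥ B) ∷ G))
theorem3p11 ℝ =
  (λ G Γ rs d → let p , q = zero-premise zero rs (inj₂ refl) in
    exchange₁ (↭-identityʳ Γ) (C (invert-principal zero Γ rs p q d))) ,
  (λ G Γ rs A B d → let p , q = plus-premise (plus A B) rs (inj₂ refl) in
    C (invert-principal (plus A B) Γ rs p q d)) ,
  (λ G Γ rs s A d → let p , q = times-premise (times s A) rs (inj₂ refl) in
    C (invert-principal (times s A) Γ rs p q d)) ,
  -- The two parts are the two sequents of the premise, so there is no contraction here.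
  (λ G Γ rs A B d → invert-principal (sup A B) Γ rs
    (↭-reflexive (concatMap-only A rs)) (↭-reflexive (concatMap-only B rs)) d) ,
  (λ G Γ rs A B d →
    let p = ↭-reflexive (concatMap-only A rs)
        q = ↭-reflexive (concatMap-only B rs)
    in C (invert-principal (inf A B A (inj₁ refl)) Γ rs p p d) ,
       C (invert-principal (inf A B B (inj₂ refl)) Γ rs q q d))
  where
  open HR ℝ
  open Derivations ℝ
  open Replacement ℝ
  open Invertibility ℝ
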